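{- Let $k$ be a positive integer. If the problem $\mathrm{PCP}(k+4)$ is decidable on erasement-free instances, then the problem $\mathrm{ACCESSIBILITY}(k)$ is decidable.
   Context: An alphabet is a finite set of letters; $\Sigma^\star$ is the set of all words over $\Sigma$, including the empty word $\varepsilon$, and $\Sigma^+ = \Sigma^\star \setminus \{\varepsilon\}$. A morphism $\sigma:\Sigma^\star\to\Delta^\star$ is a map with $\sigma(xy)=\sigma(x)\sigma(y)$ for all $x,y\in\Sigma^\star$; it is finitely encoded by its restriction to $\Sigma$. $\mathrm{PCP}$ (Post Correspondence Problem): given an alphabet $\Sigma$ and two morphisms $\sigma,\tau:\Sigma^\star\to\{0,1\}^\star$ (the instance being $(\Sigma,\sigma,\tau)$), decide whether there exists $w\in\Sigma^+$ such that $\sigma(w)=\tau(w)$. For an integer $k\ge1$, $\mathrm{PCP}(k)$ is the restriction to instances with $\Sigma$ of cardinality $k$. An instance of $\mathrm{PCP}$ is erasement-free if $\sigma(a)\neq\varepsilon$ and $\tau(a)\ne\varepsilon$ for every letter $a\in\Sigma$. A semi-Thue system is a pair $T=(\Sigma,R)$ with $\Sigma$ an alphabet and $R\subseteq\Sigma^\star\times\Sigma^\star$; elements of $R$ are its rules. Write $x\to_T y$ if there exist $z,z'\in\Sigma^\star$ and $(s,t)\in R$ with $x=zsz'$ and $y=ztz'$; $\to_T^\star$ is the reflexive-transitive closure of $\to_T$. $\mathrm{ACCESSIBILITY}(k)$: given a semi-Thue system $T$ with exactly $k$ rules and two words $u,v$ over the alphabet of $T$, decide whether $u\to_T^\star v$.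 Decidable means algorithmically decidable (computable) under the obvious finite encodings of instances; "decidable on a class of instances" refers to the problem restricted to instances in that class. -}

module Defs where

open import Data.Bool.Base using (Bool; true; false)
open import Data.Fin.Base using (Fin; zero; toℕ)
open import Data.List.Base using (List; []; [_]; _++_; foldr; tabulate; length)
open import Data.List.Membership.Propositional using (_∈_)
open import Data.List.Relation.Unary.Unique.Propositional using (Unique)
open import Data.Nat.Base using (ℕ; zero; suc)
open import Data.Product.Base using (Σ; ∃-syntax; _×_; _,_; proj₁)
open import Data.Vec.Base as Vec using (Vec; lookup; _[_]≔_)
open import Relation.Binary.Construct.Closure.ReflexiveTransitive using (Star)
open import Relation.Binary.PropositionalEquality.Core using (_≡_; _≢_)
open import Relation.Nullary.Reflects using (Reflects)

-- Algorithms are programs of the language WHILE (N. D. Jones, "Computability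
-- and Complexity from a Programming Perspective"), a Turing-complete language
-- whose data are binary trees.

infixr 5 _∙_

data Tree : Set where
  nil : Tree
  _∙_ : Tree → Tree → Tree

headᵗ tailᵗ : Tree → Tree
headᵗ nil     = nil
headᵗ (d ∙ e) = d
tailᵗ nil     = nil
tailᵗ (d ∙ e) = e

data Expr (n : ℕ) : Set where
  var   : Fin n → Expr n
  nil   : Expr n
  cons  : Expr n → Expr n → Expr n
  hd tl : Expr n → Expr n

infix  7 _:=_
infixr 6 _⨾_

data Cmd (n : ℕ) : Set where
  _:=_          : Fin n → Expr n → Cmd n
  _⨾_           : Cmd n → Cmd n → Cmd n
  if_then_else_ : Expr n → Cmd n → Cmd n → Cmd n
  while_loop_   : Expr n → Cmd n → Cmd n

Store : ℕ → Set
Store n = Vec Tree n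

eval : ∀ {n} → Expr n → Store n → Tree
eval (var x)    s = lookup s x
eval nil        s = nil
eval (cons e f) s = eval e s ∙ eval f s
eval (hd e)     s = headᵗ (eval e s)
eval (tl e)     s = tailᵗ (eval e s)

-- Big-step semantics: ⟨ c , s ⟩⇓ s′ means that c, started in the store s,
-- terminates in the store s′.  In tests, nil is false and all else is true.

infix 4 ⟨_,_⟩⇓_

data ⟨_,_⟩⇓_ {n : ℕ} : Cmd n → Store n → Store n → Set where
  assign  : ∀ {x e s} → ⟨ x := e , s ⟩⇓ (s [ x ]≔ eval e s)
  seq     : ∀ {c d s s′ s″} → ⟨ c , s ⟩⇓ s′ → ⟨ d , s′ ⟩⇓ s″ → ⟨ c ⨾ d , s ⟩⇓ s″
  if-yes  : ∀ {e c d s s′} → eval e s ≢ nil → ⟨ c , s ⟩⇓ s′ →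
            ⟨ if e then c else d , s ⟩⇓ s′
  if-no   : ∀ {e c d s s′} → eval e s ≡ nil → ⟨ d , s ⟩⇓ s′ →
            ⟨ if e then c else d , s ⟩⇓ s′
  while-go   : ∀ {e c s s′ s″} → eval e s ≢ nil → ⟨ c , s ⟩⇓ s′ →
               ⟨ while e loop c , s′ ⟩⇓ s″ → ⟨ while e loop c , s ⟩⇓ s″
  while-stop : ∀ {e c s} → eval e s ≡ nil → ⟨ while e loop c , s ⟩⇓ s

record Program : Set where
  constructor program
  field
    {others} : ℕ
    body     : Cmd (suc others)

-- Variable 0 holds the input at the start and the output at the end; every
-- other variable starts as nil.
infix 4 _on_outputs_

_on_outputs_ : Program → Tree → Tree → Set
program {m} c on d outputs e =
  ∃[ s ] ⟨ c , d Vec.∷ Vec.replicate m nil ⟩⇓ s × lookup s zero ≡ e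

encodeBool : Bool → Tree
encodeBool false = nil
encodeBool true  = nil ∙ nil

encodeℕ : ℕ → Tree
encodeℕ zero    = nil
encodeℕ (suc n) = nil ∙ encodeℕ n

encodeList : {A : Set} → (A → Tree) → List A → Tree
encodeList enc = foldr (λ a → enc a ∙_) nil

record Problem : Set₁ where
  field
    Instance : Set
    encode   : Instance → Tree
    Yes      : Instance → Set

infixl 5 _restrictedTo_

_restrictedTo_ : (P : Problem) → (Problem.Instance P → Set) → Problem
P restrictedTo C = record
  { Instance = Σ Instance C
  ; encode   = λ I → encode (proj₁ I)
  ; Yes      = λ I → Yes (proj₁ I)
  }
  where open Problem P

-- The program must halt with the right answer on every instance; nothing is
-- required of it on trees which do not encode instances.
Decidable : Problem → Set
Decidable P = ∃[ p ] ∀ I → ∃[ b ]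
  p on encode I outputs encodeBool b × Reflects (Yes I) b
  where open Problem P

-- The alphabet with n letters is Fin n.
Word : ℕ → Set
Word n = List (Fin n)

encodeWord : ∀ {n} → Word n → Tree
encodeWord = encodeList (λ a → encodeℕ (toℕ a))

record Morphism (m n : ℕ) : Set where
  field
    ⟦_⟧  : Word m → Word n
    homo : ∀ x y → ⟦ x ++ y ⟧ ≡ ⟦ x ⟧ ++ ⟦ y ⟧

open Morphism public using (⟦_⟧)

-- A morphism is encoded by the list of the images of the letters.
encodeMorphism : ∀ {m n} → Morphism m n → Tree
encodeMorphism σ = encodeList encodeWord (tabulate (λ a → ⟦ σ ⟧ [ a ]))

record PCPInstance : Set where
  field
    card : ℕ
    σ τ  : Morphism card 2

PCP : Problem
PCP = record
  { Instance = PCPInstance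
  ; encode   = λ I → let open PCPInstance I in
                 encodeℕ card ∙ encodeMorphism σ ∙ encodeMorphism τ
  ; Yes      = λ I → let open PCPInstance I in
                 ∃[ w ] w ≢ [] × ⟦ σ ⟧ w ≡ ⟦ τ ⟧ w
  }

PCP[_] : ℕ → Problem
PCP[ k ] = PCP restrictedTo λ I → PCPInstance.card I ≡ k

ErasementFree : PCPInstance → Set
ErasementFree I = ∀ a → ⟦ σ ⟧ [ a ] ≢ [] × ⟦ τ ⟧ [ a ] ≢ []
  where open PCPInstance I

-- The set R of rules is finite, given by a repetition-free enumeration, so
-- that its cardinality is the length of the list.
record SemiThue : Set where
  field
    card   : ℕ
    rules  : List (Word card × Word card)
    unique : Unique rules

  infix 4 _⟶_ _⟶*_

  _⟶_ : Word card → Word card → Set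
  x ⟶ y = ∃[ z ] ∃[ z′ ] ∃[ s ] ∃[ t ]
    (s , t) ∈ rules × x ≡ z ++ s ++ z′ × y ≡ z ++ t ++ z′

  _⟶*_ : Word card → Word card → Set
  _⟶*_ = Star _⟶_

  encodeSemiThue : Tree
  encodeSemiThue =
    encodeℕ card ∙ encodeList (λ (s , t) → encodeWord s ∙ encodeWord t) rules

record AccessibilityInstance : Set where
  field
    system : SemiThue
  open SemiThue system public
  field
    u v : Word card

Accessibility : Problem
Accessibility = record
  { Instance = AccessibilityInstance
  ; encode   = λ I → let open AccessibilityInstance I in
                 encodeSemiThue ∙ encodeWord u ∙ encodeWord v
  ; Yes      = λ I → let open AccessibilityInstance I in u ⟶* v
  }

Accessibility[_] : ℕ → Problem
Accessibility[ k ] =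
  Accessibility restrictedTo λ I → length (AccessibilityInstance.rules I) ≡ k

{-# OPTIONS --safe #-}
module Submission where

-- A word x is coded by a binary word hat x which is delimited by 1 on both sides,
-- and a queue holding hat x ++ H, where H is a block of zeros too long to occur in
-- a code, is rotated bit by bit; a rule is applied when its left-hand side comes to
-- the front.  Since H cannot be part of a left-hand side, the queue goes from
-- hat u ++ H to hat v ++ H exactly when v is derivable from u.  The moves of the
-- queue are the two bits and the k rules; as a correspondence problem, the contents
-- of the queue is what the second morphism is ahead by.  Two further letters
-- start and stop the process, and writing a separator before (in σ) or after
-- (in τ) each bit prevents the copying letters from being solutions by themselves.
-- The reduction is computed by terms of a small functional language with folds,
-- compiled to WHILE.

open import Data.Bool.Base using (Bool; true; false)
open import Data.Fin.Base using (Fin; zero; suc; toℕ; punchIn)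
open import Data.Fin.Properties using (toℕ-injective; toℕ<n)
open import Data.List.Base
  using (List; []; _∷_; [_]; _++_; _ʳ++_; concatMap; foldl; foldr; length; lookup;
         map; replicate; reverse; tabulate)
open import Data.List.Membership.Propositional.Properties using (∈-lookup)
open import Data.List.Properties
  using (++-assoc; ++-identityʳ; ++-cancelˡ; ++-conicalˡ; ++-conicalʳ;
         ∷-injective; ∷-injectiveˡ; ∷-injectiveʳ; concatMap-++; concatMap-map; foldr-++;
         length-++; map-tabulate; reverse-foldl; tabulate-cong; tabulate-lookup)
open import Data.List.Relation.Binary.Permutation.Propositional.Properties
  using (↭-length; shifts)
open import Data.List.Relation.Unary.Any using (index)
open import Data.List.Relation.Unary.Any.Properties using (lookup-index)
open import Data.Nat.Base using (ℕ; zero; suc; _+_; _<_; _≥_; s≤s)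
open import Data.Nat.Properties using (m≤n⇒m≤1+n; <⇒≤; +-cancelˡ-≡; +-comm; +-identityʳ)
open import Data.Product.Base using (∃-syntax; _×_; _,_; proj₁; proj₂)
open import Data.Vec.Base as Vec using (Vec; []; _∷_; _[_]≔_; insertAt)
open import Data.Vec.Properties using (insertAt-punchIn)
open import Function.Base using (id; _∘_)
open import Relation.Binary.Construct.Closure.ReflexiveTransitive using (ε; _◅_; _◅◅_)
open import Relation.Binary.PropositionalEquality
  using (_≡_; _≢_; refl; sym; trans; cong; cong₂; subst; subst₂; module ≡-Reasoning)
open import Relation.Nullary.Negation using (contradiction)
open import Relation.Nullary.Reflects using (Reflects; ofʸ; ofⁿ)
open import Defs

open ≡-Reasoning

-- Binary codes of words

zeros : ℕ → List Bool
zeros n = replicate n false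

-- hat (a₁ … aₙ) is 1 0^a₁ 1 0^a₂ 1 … 1 0^aₙ 1.  A delimiter at both ends keeps
-- the code of the empty word nonempty, and makes the factors of hat x of the
-- form hat s correspond to the factors s of x.
hat gaps : ∀ {n} → Word n → List Bool
hat s = true ∷ gaps s
gaps []      = []
gaps (a ∷ s) = zeros (toℕ a) ++ hat s

zeros-true-cancel : ∀ a b {X Y} →
  zeros a ++ true ∷ X ≡ zeros b ++ true ∷ Y → a ≡ b × X ≡ Y
zeros-true-cancel zero    zero    eq = refl , ∷-injectiveʳ eq
zeros-true-cancel (suc a) (suc b) eq
  with refl , eq′ ← zeros-true-cancel a b (∷-injectiveʳ eq) = refl , eq′

zeros-split : ∀ a c {Y Z} → zeros a ++ Y ≡ c ++ true ∷ Z →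
  ∃[ c′ ] c ≡ zeros a ++ c′ × Y ≡ c′ ++ true ∷ Z
zeros-split zero    c       eq = c , refl , eq
zeros-split (suc a) (x ∷ c) eq
  with refl , eq′ ← ∷-injective eq
  with c′ , refl , eq″ ← zeros-split a c eq′ = c′ , refl , eq″

zeros-≢ : ∀ {a N} → a < N → ∀ {Y Z} → zeros a ++ true ∷ Y ≢ zeros N ++ Z
zeros-≢ {zero}  {suc N} _         ()
zeros-≢ {suc a} {suc N} (s≤s a<N) eq = zeros-≢ a<N (∷-injectiveʳ eq)

-- A block of `N` zeros starting at or before the first 1 would run over that 1, as `a < N`; so it
-- can only start behind it.
zeros-block : ∀ {a N} → a < N → ∀ e {Y Z} → zeros a ++ true ∷ Y ≡ e ++ zeros N ++ Z →
  ∃[ e′ ] e ≡ zeros a ++ true ∷ e′ × Y ≡ e′ ++ zeros N ++ Z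
zeros-block         a<N []      eq = contradiction eq (zeros-≢ a<N)
zeros-block {zero}  a<N (x ∷ e) eq with refl , eq′ ← ∷-injective eq = e , refl , eq′
zeros-block {suc a} a<N (x ∷ e) eq
  with refl , eq′ ← ∷-injective eq
  with e′ , refl , eq″ ← zeros-block (<⇒≤ a<N) e eq′ = e′ , refl , eq″

-- The final zeros contain no 1, so the given 1 lies in `X`. For a rotated queue: a cut in front of
-- a 1 falls inside the code, never inside the block.
zeros-suffix : ∀ c {d} X {N} → c ++ true ∷ d ≡ X ++ zeros N →
  ∃[ e ] d ≡ e ++ zeros N × c ++ true ∷ e ≡ X
zeros-suffix []      []      {suc N} ()
zeros-suffix []      (x ∷ X) eq with refl , eq′ ← ∷-injective eq = X , eq′ , refl
zeros-suffix (x ∷ c) []      {suc N} eq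
  with e , _ , eq′ ← zeros-suffix c [] (∷-injectiveʳ eq) =
  contradiction (++-conicalʳ c _ eq′) λ ()
zeros-suffix (x ∷ c) (y ∷ X) eq
  with refl , eq′ ← ∷-injective eq
  with e , eq″ , refl ← zeros-suffix c X eq′ = e , eq″ , refl

++-squeeze : ∀ {A : Set} (xs : List A) {ys zs} → xs ++ ys ++ zs ≡ ys → xs ≡ [] × zs ≡ []
++-squeeze xs {ys} {zs} eq = ++-conicalˡ xs zs both , ++-conicalʳ xs zs both
  where
  both : xs ++ zs ≡ []
  both = length-0 (+-cancelˡ-≡ (length ys) _ 0 (begin
    length ys + length (xs ++ zs)         ≡⟨ length-++ ys ⟨
    length (ys ++ xs ++ zs)               ≡⟨ ↭-length (shifts ys xs) ⟩
    length (xs ++ ys ++ zs)               ≡⟨ cong length eq ⟩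
    length ys                             ≡⟨ +-identityʳ _ ⟨
    length ys + 0                         ∎))
    where
    length-0 : ∀ {xs : List _} → length xs ≡ 0 → xs ≡ []
    length-0 {[]} _ = refl

-- Gaps in a code over `n` letters have fewer than `n` zeros, so no code contains this block; the
-- successor keeps it nonempty even over the empty alphabet.
pad : ℕ → List Bool
pad n = zeros (suc n)

-- A code read from the front of the queue stops before the block, since its gaps are shorter and it
-- ends with 1: letter by letter, `zeros-block` places a gap and its delimiter inside `e`.
hat-prefix : ∀ {n} (s : Word n) e {p Z} → hat s ++ p ≡ true ∷ e ++ pad n ++ Z →
  ∃[ e′ ] true ∷ e ≡ hat s ++ e′
hat-prefix []      e     eq = e , refl
hat-prefix (a ∷ s) e {p} eq
  with e′ , refl , eq′ ← zeros-block (m≤n⇒m≤1+n (toℕ<n a)) e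
         (trans (sym (++-assoc (zeros (toℕ a)) (hat s) p)) (∷-injectiveʳ eq))
  with e″ , eq″ ← hat-prefix s e′ (cong (true ∷_) eq′) =
  e″ , cong (true ∷_) (trans (cong (zeros (toℕ a) ++_) eq″)
                             (sym (++-assoc (zeros (toℕ a)) (hat s) e″)))

hat-injective : ∀ {n} (x y : Word n) → hat x ≡ hat y → x ≡ y
hat-injective []      []      eq = refl
hat-injective []      (b ∷ y) eq = contradiction (++-conicalʳ (zeros (toℕ b)) _ (sym (∷-injectiveʳ eq))) λ ()
hat-injective (a ∷ x) []      eq = contradiction (++-conicalʳ (zeros (toℕ a)) _ (∷-injectiveʳ eq)) λ ()
hat-injective (a ∷ x) (b ∷ y) eq
  with a≡b , eq′ ← zeros-true-cancel (toℕ a) (toℕ b) (∷-injectiveʳ eq) =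
  cong₂ _∷_ (toℕ-injective a≡b) (hat-injective x y (cong (true ∷_) eq′))

hat-++ : ∀ {n} (z : Word n) → ∃[ e ] ∀ s → hat (s ++ z) ≡ hat s ++ e
hat-++ z = gaps z , go
  where
  go : ∀ s → hat (s ++ z) ≡ hat s ++ gaps z
  go []      = refl
  go (a ∷ s) = cong (true ∷_) (trans (cong (zeros (toℕ a) ++_) (go s))
                                     (sym (++-assoc (zeros (toℕ a)) (hat s) (gaps z))))

-- `c` and `e` are chosen before `s`, so that one context serves both sides of a rule.
hat-factor : ∀ {n} (z z′ : Word n) →
  ∃[ c ] ∃[ e ] ∀ s → hat (z ++ s ++ z′) ≡ c ++ hat s ++ e
hat-factor []      z′ = [] , hat-++ z′
hat-factor (a ∷ z) z′ with c , e , eq ← hat-factor z z′ =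
  true ∷ zeros (toℕ a) ++ c , e , λ s → cong (true ∷_)
    (trans (cong (zeros (toℕ a) ++_) (eq s)) (sym (++-assoc (zeros (toℕ a)) c (hat s ++ e))))

unhat-++ : ∀ {n} (x s : Word n) e → hat x ≡ hat s ++ e →
  ∃[ z ] x ≡ s ++ z × e ≡ gaps z
unhat-++ x       []      e eq = x , refl , sym (∷-injectiveʳ eq)
unhat-++ []      (a ∷ s) e eq with zeros (toℕ a) | ∷-injectiveʳ eq
... | []    | ()
... | _ ∷ _ | ()
unhat-++ (b ∷ x) (a ∷ s) e eq
  with b≡a , eq′ ← zeros-true-cancel (toℕ b) (toℕ a)
         (trans (∷-injectiveʳ eq) (++-assoc (zeros (toℕ a)) (hat s) e))
  with z , refl , eq″ ← unhat-++ x s e (cong (true ∷_) eq′) =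
  z , cong (_∷ s ++ z) (toℕ-injective b≡a) , eq″

-- As `hat s` starts with 1, it starts at a delimiter of `hat x`; as each of its gaps is closed by a
-- 1, gaps are compared in full. The context found this way then accepts any `hat t`.
unhat-factor : ∀ {n} (x s : Word n) c e → hat x ≡ c ++ hat s ++ e →
  ∃[ z ] ∃[ z′ ] x ≡ z ++ s ++ z′ × ∀ t → c ++ hat t ++ e ≡ hat (z ++ t ++ z′)
unhat-factor x s [] e eq
  with z′ , refl , refl ← unhat-++ x s e eq =
  [] , z′ , refl , λ t → sym (proj₂ (hat-++ z′) t)
unhat-factor []      s (true ∷ c) e eq =
  contradiction (++-conicalʳ c _ (sym (∷-injectiveʳ eq))) λ ()
unhat-factor (a ∷ x) s (true ∷ c) e eq
  with c′ , refl , eq′ ← zeros-split (toℕ a) c (∷-injectiveʳ eq)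
  with z , z′ , refl , f ← unhat-factor x s c′ e eq′ =
  a ∷ z , z′ , refl , λ t → cong (true ∷_)
    (trans (++-assoc (zeros (toℕ a)) c′ (hat t ++ e)) (cong (zeros (toℕ a) ++_) (f t)))

-- The queue

module Queue (T : SemiThue) where

  open SemiThue T

  H : List Bool
  H = pad card

  Letter : Set
  Letter = Fin (2 + length rules)

  lhs rhs : Letter → List Bool
  lhs zero          = [ false ]
  lhs (suc zero)    = [ true ]
  lhs (suc (suc i)) = hat (proj₁ (lookup rules i))
  rhs zero          = [ false ]
  rhs (suc zero)    = [ true ]
  rhs (suc (suc i)) = hat (proj₂ (lookup rules i))

  lhs* rhs* : List Letter → List Bool
  lhs* = concatMap lhs
  rhs* = concatMap rhs

  -- A letter i removes lhs i from the front of the queue and appends rhs i at its back.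
  infix 4 _⇝_

  _⇝_ : List Bool → List Bool → Set
  q ⇝ q′ = ∃[ w ] q ++ rhs* w ≡ lhs* w ++ q′

  ⇝-refl : ∀ {q} → q ⇝ q
  ⇝-refl = [] , ++-identityʳ _

  ⇝-trans : ∀ {p q r} → p ⇝ q → q ⇝ r → p ⇝ r
  ⇝-trans {p} {q} {r} (v , eqv) (w , eqw) = v ++ w , (begin
    p ++ rhs* (v ++ w)       ≡⟨ cong (p ++_) (concatMap-++ rhs v w) ⟩
    p ++ rhs* v ++ rhs* w    ≡⟨ ++-assoc p (rhs* v) (rhs* w) ⟨
    (p ++ rhs* v) ++ rhs* w  ≡⟨ cong (_++ rhs* w) eqv ⟩
    (lhs* v ++ q) ++ rhs* w  ≡⟨ ++-assoc (lhs* v) q (rhs* w) ⟩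
    lhs* v ++ q ++ rhs* w    ≡⟨ cong (lhs* v ++_) eqw ⟩
    lhs* v ++ lhs* w ++ r    ≡⟨ ++-assoc (lhs* v) (lhs* w) r ⟨
    (lhs* v ++ lhs* w) ++ r  ≡⟨ cong (_++ r) (concatMap-++ lhs v w) ⟨
    lhs* (v ++ w) ++ r       ∎)

  ⇝-letter : ∀ i p → lhs i ++ p ⇝ p ++ rhs i
  ⇝-letter i p = [ i ] , (begin
    (lhs i ++ p) ++ rhs i ++ []  ≡⟨ cong ((lhs i ++ p) ++_) (++-identityʳ (rhs i)) ⟩
    (lhs i ++ p) ++ rhs i        ≡⟨ ++-assoc (lhs i) p (rhs i) ⟩
    lhs i ++ p ++ rhs i          ≡⟨ cong (_++ p ++ rhs i) (++-identityʳ (lhs i)) ⟨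
    (lhs i ++ []) ++ p ++ rhs i  ∎)

  ⇝-rotate : ∀ x p → x ++ p ⇝ p ++ x
  ⇝-rotate []      p = subst (p ⇝_) (sym (++-identityʳ p)) ⇝-refl
  ⇝-rotate (b ∷ x) p = ⇝-trans (⇝-copy b) (subst₂ _⇝_ (sym (++-assoc x p [ b ]))
    (++-assoc p [ b ] x) (⇝-rotate x (p ++ [ b ])))
    where
    ⇝-copy : ∀ b → b ∷ x ++ p ⇝ (x ++ p) ++ [ b ]
    ⇝-copy false = ⇝-letter zero (x ++ p)
    ⇝-copy true  = ⇝-letter (suc zero) (x ++ p)

  -- Copying `c` brings `lhs i` to the front, the letter `i` trades it for `rhs i` behind `d ++ c`,
  -- and copying `d` restores the order.
  ⇝-rewrite : ∀ i c d → c ++ lhs i ++ d ⇝ c ++ rhs i ++ d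
  ⇝-rewrite i c d =
    ⇝-trans (subst (c ++ lhs i ++ d ⇝_) (++-assoc (lhs i) d c) (⇝-rotate c (lhs i ++ d)))
   (⇝-trans (⇝-letter i (d ++ c))
            (subst₂ _⇝_ (sym (++-assoc d c (rhs i))) (++-assoc c (rhs i) d)
              (⇝-rotate d (c ++ rhs i))))

  ⟶⇒⇝ : ∀ {x y} → x ⟶ y → hat x ++ H ⇝ hat y ++ H
  ⟶⇒⇝ (z , z′ , s , t , st∈ , refl , refl)
    with c , e , eq ← hat-factor z z′
    with i ← index st∈ | refl ← lookup-index st∈ =
    subst₂ _⇝_ (shape s) (shape t) (⇝-rewrite (suc (suc i)) c (e ++ H))
    where
    shape : ∀ s → c ++ hat s ++ e ++ H ≡ hat (z ++ s ++ z′) ++ H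
    shape s = begin
      c ++ hat s ++ e ++ H      ≡⟨ cong (c ++_) (++-assoc (hat s) e H) ⟨
      c ++ (hat s ++ e) ++ H    ≡⟨ ++-assoc c (hat s ++ e) H ⟨
      (c ++ hat s ++ e) ++ H    ≡⟨ cong (_++ H) (eq s) ⟨
      hat (z ++ s ++ z′) ++ H   ∎

  ⟶*⇒⇝ : ∀ {x y} → x ⟶* y → hat x ++ H ⇝ hat y ++ H
  ⟶*⇒⇝ ε        = ⇝-refl
  ⟶*⇒⇝ (r ◅ rs) = ⇝-trans (⟶⇒⇝ r) (⟶*⇒⇝ rs)

  -- Up to rotation, the queue always holds hat x ++ H for some x derivable from u.
  data Reachable (u : Word card) : List Bool → Set where
    rotated : ∀ {x} → u ⟶* x → ∀ c a d → c ++ a ∷ d ≡ hat x ++ H →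
              Reachable u (a ∷ d ++ c)

  -- `rotated` always exposes a front bit, so that matching on it reveals the head of the queue; a
  -- cut at the very end is the same rotation as one at the start.
  reachable : ∀ {u x} → u ⟶* x → ∀ c d → c ++ d ≡ hat x ++ H → Reachable u (d ++ c)
  reachable u⟶*x c       (a ∷ d) eq = rotated u⟶*x c a d eq
  reachable u⟶*x []      []      ()
  reachable u⟶*x (a ∷ c) []      eq =
    subst (λ e → Reachable _ (a ∷ e)) (++-identityʳ c)
      (rotated u⟶*x [] a c (trans (sym (++-identityʳ (a ∷ c))) eq))

  reachable-start : ∀ u → Reachable u (hat u ++ H)
  reachable-start u = subst (Reachable u) (++-identityʳ _) (reachable ε [] (hat u ++ H) refl)

  reachable-copy : ∀ {u b p q p′} → Reachable u q → b ∷ p ≡ q ++ p′ →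
    ∃[ r ] q ≡ b ∷ r × Reachable u (r ++ [ b ])
  reachable-copy (rotated {x} u⟶*x c a d eq) eq′ with refl ← ∷-injectiveˡ eq′ =
    d ++ c , refl , subst (Reachable _) (sym (++-assoc d c [ a ]))
      (reachable u⟶*x (c ++ [ a ]) d (trans (++-assoc c [ a ] d) eq))

  -- The equation only makes `lhs i` and `q` comparable as prefixes. For a bit it is enough that `q`
  -- is nonempty. For a rule the block decides: `hat-prefix` keeps the match inside the code, and
  -- `unhat-factor` turns it into a rewriting step.
  reachable-step : ∀ {u q p p′} i → Reachable u q → lhs i ++ p ≡ q ++ p′ →
    ∃[ r ] q ≡ lhs i ++ r × Reachable u (r ++ rhs i)
  reachable-step zero          R eq = reachable-copy R eq
  reachable-step (suc zero)    R eq = reachable-copy R eq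
  reachable-step {p′ = p′} (suc (suc i)) (rotated {x} u⟶*x c a d eq) eq′
    with refl ← ∷-injectiveˡ eq′
    -- A left-hand side starts with 1, so the cut lies inside `hat x` and `H` is not split.
    with e , refl , eq₁ ← zeros-suffix c (hat x) eq
    with e′ , eq₂ ← hat-prefix (proj₁ (lookup rules i)) e (trans eq′ (cong (true ∷_)
           (trans (++-assoc (e ++ H) c p′) (++-assoc e H (c ++ p′)))))
    with z , z′ , refl , f ← unhat-factor x (proj₁ (lookup rules i)) c e′
           (trans (sym eq₁) (cong (c ++_) eq₂)) =
      (e′ ++ H) ++ c
    , trans (cong (λ l → (l ++ H) ++ c) eq₂)
        (trans (cong (_++ c) (++-assoc (hat s) e′ H)) (++-assoc (hat s) (e′ ++ H) c))
    , subst (Reachable _) (sym (++-assoc (e′ ++ H) c (hat t)))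
        -- The new code `hat t` joins `c` at the back of the queue, so the cut now lies behind
        -- `hat t`.
        (reachable (u⟶*x ◅◅ ((z , z′ , s , t , ∈-lookup i , refl , refl) ◅ ε))
          (c ++ hat t) (e′ ++ H) (begin
            (c ++ hat t) ++ e′ ++ H  ≡⟨ ++-assoc (c ++ hat t) e′ H ⟨
            ((c ++ hat t) ++ e′) ++ H ≡⟨ cong (_++ H) (++-assoc c (hat t) e′) ⟩
            (c ++ hat t ++ e′) ++ H  ≡⟨ cong (_++ H) (f t) ⟩
            hat (z ++ t ++ z′) ++ H ∎))
    where
    s t : Word card
    s = proj₁ (lookup rules i)
    t = proj₂ (lookup rules i)

  -- `hat v` must fit in front of the block; cancelling it leaves `H` with `e′` before and `c`
  -- behind, equal to `H` alone. By length both are empty, so the rotation is trivial and `x` is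
  -- `v`.
  reachable-end : ∀ {u v} → Reachable u (hat v ++ H) → u ⟶* v
  reachable-end {u} {v} R = go R refl
    where
    go : ∀ {q} → Reachable u q → q ≡ hat v ++ H → u ⟶* v
    go (rotated {x} u⟶*x c a d eq) eq′
      with refl ← ∷-injectiveˡ eq′
      with e , refl , eq₁ ← zeros-suffix c (hat x) eq
      with e′ , eq₂ ← hat-prefix v e {H} {c}
             (trans (sym eq′) (cong (true ∷_) (++-assoc e H c)))
      with refl , refl ← ++-squeeze e′ {H} {c} (++-cancelˡ (hat v) _ _ (begin
             hat v ++ e′ ++ H ++ c     ≡⟨ ++-assoc (hat v) e′ (H ++ c) ⟨
             (hat v ++ e′) ++ H ++ c   ≡⟨ cong (_++ H ++ c) eq₂ ⟨
             true ∷ e ++ H ++ c        ≡⟨ cong (true ∷_) (++-assoc e H c) ⟨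
             true ∷ (e ++ H) ++ c      ≡⟨ eq′ ⟩
             hat v ++ H                ∎)) =
      subst (u ⟶*_) (hat-injective x v (trans (sym eq₁) (trans eq₂ (++-identityʳ (hat v))))) u⟶*x

-- Correspondence problems

data Symbol : Set where
  bit      : Bool → Symbol
  sep mark : Symbol

sepˡ sepʳ : List Bool → List Symbol
sepˡ = concatMap λ b → sep ∷ bit b ∷ []
sepʳ = concatMap λ b → bit b ∷ sep ∷ []

sepˡ-++ : ∀ x y → sepˡ (x ++ y) ≡ sepˡ x ++ sepˡ y
sepˡ-++ = concatMap-++ _

-- One separator in front turns trailing separators into leading ones. It is supplied by `τ₀` of
-- begin and absorbed by the `sep` before `mark` in `σ₀` of end.
sep∷sepʳ : ∀ x {Z} → sep ∷ sepʳ x ++ Z ≡ sepˡ x ++ sep ∷ Z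
sep∷sepʳ []      = refl
sep∷sepʳ (b ∷ x) = cong (λ z → sep ∷ bit b ∷ z) (sep∷sepʳ x)

-- Bits are compared until one word is exhausted; the resulting comparability is what
-- `reachable-step` asks for.
sepˡ-comparable : ∀ x y {X Y} → sepˡ x ++ X ≡ sepˡ y ++ Y →
  ∃[ p ] ∃[ p′ ] x ++ p ≡ y ++ p′
sepˡ-comparable []      y       eq = y , [] , sym (++-identityʳ y)
sepˡ-comparable (a ∷ x) []      eq = [] , a ∷ x , ++-identityʳ (a ∷ x)
sepˡ-comparable (a ∷ x) (b ∷ y) eq
  with refl , eq′ ← ∷-injective (∷-injectiveʳ eq)
  with p , p′ , eq″ ← sepˡ-comparable x y eq′ = p , p′ , cong (a ∷_) eq″

sepˡ-mark-cancel : ∀ x y {X Y} →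
  sepˡ x ++ sep ∷ mark ∷ X ≡ sepˡ y ++ sep ∷ mark ∷ Y → x ≡ y
sepˡ-mark-cancel []      []      eq = refl
sepˡ-mark-cancel (a ∷ x) (b ∷ y) eq with refl , eq′ ← ∷-injective (∷-injectiveʳ eq) =
  cong (a ∷_) (sepˡ-mark-cancel x y eq′)
sepˡ-mark-cancel []      (b ∷ y) ()
sepˡ-mark-cancel (a ∷ x) []      ()

code : Symbol → Word 2
code (bit false) = zero     ∷ zero     ∷ []
code (bit true)  = zero     ∷ suc zero ∷ []
code sep         = suc zero ∷ zero     ∷ []
code mark        = suc zero ∷ suc zero ∷ []

code* : List Symbol → Word 2
code* = concatMap code

code*-injective : ∀ x y → code* x ≡ code* y → x ≡ y
code*-injective x y eq = trans (sym (decode-code* x)) (trans (cong decode eq) (decode-code* y))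
  where
  decode : Word 2 → List Symbol
  decode (zero     ∷ zero     ∷ w) = bit false ∷ decode w
  decode (zero     ∷ suc zero ∷ w) = bit true ∷ decode w
  decode (suc zero ∷ zero     ∷ w) = sep ∷ decode w
  decode (suc zero ∷ suc zero ∷ w) = mark ∷ decode w
  decode _                         = []
  decode-code* : ∀ x → decode (code* x) ≡ x
  decode-code* []              = refl
  decode-code* (bit false ∷ x) = cong (bit false ∷_) (decode-code* x)
  decode-code* (bit true ∷ x)  = cong (bit true ∷_) (decode-code* x)
  decode-code* (sep ∷ x)       = cong (sep ∷_) (decode-code* x)
  decode-code* (mark ∷ x)      = cong (mark ∷_) (decode-code* x)

concatMap-concatMap : ∀ {A B C : Set} (f : B → List C) (g : A → List B) x →
  concatMap (λ a → concatMap f (g a)) x ≡ concatMap f (concatMap g x)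
concatMap-concatMap f g []      = refl
concatMap-concatMap f g (a ∷ x) =
  trans (cong (concatMap f (g a) ++_) (concatMap-concatMap f g x))
        (sym (concatMap-++ f (g a) (concatMap g x)))

module PostSystem (I : AccessibilityInstance) where

  open AccessibilityInstance I
  open Queue system

  -- The letters are, in order: begin, end, and those of the queue.
  σ₀ τ₀ : Fin (4 + length rules) → List Symbol
  σ₀ zero          = [ mark ]
  σ₀ (suc zero)    = sepˡ (hat v ++ H) ++ sep ∷ mark ∷ []
  σ₀ (suc (suc i)) = sepˡ (lhs i)
  τ₀ zero          = mark ∷ sepˡ (hat u ++ H) ++ sep ∷ []
  τ₀ (suc zero)    = [ mark ]
  τ₀ (suc (suc i)) = sepʳ (rhs i)

  σ₀* τ₀* : Word (4 + length rules) → List Symbol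
  σ₀* = concatMap σ₀
  τ₀* = concatMap τ₀

  morphism : (Fin (4 + length rules) → List Symbol) → Morphism (4 + length rules) 2
  morphism f = record
    { ⟦_⟧  = concatMap λ a → code* (f a)
    ; homo = concatMap-++ _
    }

  pcp : PCPInstance
  pcp = record { card = 4 + length rules ; σ = morphism σ₀ ; τ = morphism τ₀ }

  -- Rules with an empty side are covered too, because `hat []` is a single delimiter.
  pcp-erasementFree : ErasementFree pcp
  pcp-erasementFree zero                = (λ ()) , (λ ())
  pcp-erasementFree (suc zero)          = (λ ()) , (λ ())
  pcp-erasementFree (suc (suc zero))    = (λ ()) , (λ ())
  pcp-erasementFree (suc (suc (suc zero)))    = (λ ()) , (λ ())
  pcp-erasementFree (suc (suc (suc (suc i)))) = (λ ()) , (λ ())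

  code-σ₀* : ∀ w → ⟦ morphism σ₀ ⟧ w ≡ code* (σ₀* w)
  code-σ₀* = concatMap-concatMap code σ₀

  code-τ₀* : ∀ w → ⟦ morphism τ₀ ⟧ w ≡ code* (τ₀* w)
  code-τ₀* = concatMap-concatMap code τ₀

  letters letters′ : List Letter → Word (4 + length rules)
  letters  = map (λ i → suc (suc i))
  letters′ w = zero ∷ letters w ++ [ suc zero ]

  -- Around a run `w` of the queue, both images read `mark`, the separated bits of
  -- `lhs* w ++ hat v ++ H`, `sep`, `mark`.
  solution : u ⟶* v → Problem.Yes PCP pcp
  solution u⟶*v with w , eq ← ⟶*⇒⇝ u⟶*v =
      letters′ w
    , (λ ())
    , trans (code-σ₀* (letters′ w))
        (trans (cong code* (cong (mark ∷_) (begin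
          σ₀* (letters w ++ [ suc zero ])
            ≡⟨ concatMap-++ σ₀ (letters w) _ ⟩
          σ₀* (letters w) ++ (sepˡ (hat v ++ H) ++ sep ∷ mark ∷ []) ++ []
            ≡⟨ cong (σ₀* (letters w) ++_) (++-identityʳ _) ⟩
          σ₀* (letters w) ++ sepˡ (hat v ++ H) ++ sep ∷ mark ∷ []
            ≡⟨ cong (_++ sepˡ (hat v ++ H) ++ sep ∷ mark ∷ []) (map-letters w) ⟩
          sepˡ (lhs* w) ++ sepˡ (hat v ++ H) ++ sep ∷ mark ∷ []
            ≡⟨ ++-assoc (sepˡ (lhs* w)) _ _ ⟨
          (sepˡ (lhs* w) ++ sepˡ (hat v ++ H)) ++ sep ∷ mark ∷ []
            ≡⟨ cong (_++ sep ∷ mark ∷ []) (sepˡ-++ (lhs* w) (hat v ++ H)) ⟨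
          sepˡ (lhs* w ++ hat v ++ H) ++ sep ∷ mark ∷ []
            ≡⟨ cong (λ q → sepˡ q ++ sep ∷ mark ∷ []) eq ⟨
          sepˡ ((hat u ++ H) ++ rhs* w) ++ sep ∷ mark ∷ []
            ≡⟨ cong (_++ sep ∷ mark ∷ []) (sepˡ-++ (hat u ++ H) (rhs* w)) ⟩
          (sepˡ (hat u ++ H) ++ sepˡ (rhs* w)) ++ sep ∷ mark ∷ []
            ≡⟨ ++-assoc (sepˡ (hat u ++ H)) _ _ ⟩
          sepˡ (hat u ++ H) ++ sepˡ (rhs* w) ++ sep ∷ mark ∷ []
            ≡⟨ cong (sepˡ (hat u ++ H) ++_) (sep∷sepʳ (rhs* w)) ⟨
          sepˡ (hat u ++ H) ++ sep ∷ sepʳ (rhs* w) ++ mark ∷ []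
            ≡⟨ ++-assoc (sepˡ (hat u ++ H)) _ _ ⟨
          (sepˡ (hat u ++ H) ++ sep ∷ []) ++ sepʳ (rhs* w) ++ mark ∷ []
            ≡⟨ cong (λ z → (sepˡ (hat u ++ H) ++ sep ∷ []) ++ z ++ mark ∷ []) (map-letters′ w) ⟨
          (sepˡ (hat u ++ H) ++ sep ∷ []) ++ τ₀* (letters w) ++ mark ∷ []
            ≡⟨ cong ((sepˡ (hat u ++ H) ++ sep ∷ []) ++_) (concatMap-++ τ₀ (letters w) _) ⟨
          (sepˡ (hat u ++ H) ++ sep ∷ []) ++ τ₀* (letters w ++ [ suc zero ]) ∎)))
        (sym (code-τ₀* (letters′ w))))
    where
    map-letters : ∀ w → σ₀* (letters w) ≡ sepˡ (lhs* w)
    map-letters w = trans (concatMap-map σ₀ (λ i → suc (suc i)) w) (concatMap-concatMap _ lhs w)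
    map-letters′ : ∀ w → τ₀* (letters w) ≡ sepʳ (rhs* w)
    map-letters′ w = trans (concatMap-map τ₀ (λ i → suc (suc i)) w) (concatMap-concatMap _ rhs w)

  -- The hypothesis says that τ is ahead of σ by sepˡ q ++ [ sep ].
  ahead : ∀ w {q} → Reachable u q → sepˡ q ++ sep ∷ τ₀* w ≡ σ₀* w → u ⟶* v
  -- Matching on `rotated` lets the left side compute: it starts with `sep`, while the right side is
  -- empty or starts with `mark`.
  ahead []                  (rotated _ _ _ _ _) ()
  ahead (zero ∷ w)          (rotated _ _ _ _ _) ()
  ahead (suc zero ∷ w)  {q} R eq =
    -- The first `mark` on either side ends the queue contents, so `q` is `hat v ++ H` and the
    -- derivation is complete, whatever letters follow.
    reachable-end (subst (Reachable u)
      (sepˡ-mark-cancel q (hat v ++ H) (trans eq (++-assoc (sepˡ (hat v ++ H)) _ _))) R)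
  ahead (suc (suc i) ∷ w) {q} R eq
    with p , p′ , eq′ ← sepˡ-comparable (lhs i) q (sym eq)
    with r , refl , R′ ← reachable-step i R eq′ =
    -- Once the bits of `lhs i` are cancelled, the lone `sep` moves past `sepʳ (rhs i)` and closes
    -- the lead again.
    ahead w R′ (++-cancelˡ (sepˡ (lhs i)) _ _ (begin
      sepˡ (lhs i) ++ sepˡ (r ++ rhs i) ++ sep ∷ τ₀* w
        ≡⟨ cong (λ z → sepˡ (lhs i) ++ z ++ sep ∷ τ₀* w) (sepˡ-++ r (rhs i)) ⟩
      sepˡ (lhs i) ++ (sepˡ r ++ sepˡ (rhs i)) ++ sep ∷ τ₀* w
        ≡⟨ cong (sepˡ (lhs i) ++_) (++-assoc (sepˡ r) _ _) ⟩
      sepˡ (lhs i) ++ sepˡ r ++ sepˡ (rhs i) ++ sep ∷ τ₀* w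
        ≡⟨ ++-assoc (sepˡ (lhs i)) _ _ ⟨
      (sepˡ (lhs i) ++ sepˡ r) ++ sepˡ (rhs i) ++ sep ∷ τ₀* w
        ≡⟨ cong₂ _++_ (sepˡ-++ (lhs i) r) (sep∷sepʳ (rhs i)) ⟨
      sepˡ (lhs i ++ r) ++ sep ∷ sepʳ (rhs i) ++ τ₀* w
        ≡⟨ eq ⟩
      sepˡ (lhs i) ++ σ₀* w ∎))

  -- Only the letter begin has images starting with the same symbol.
  derivation : Problem.Yes PCP pcp → u ⟶* v
  derivation (w , w≢[] , eq) = start w w≢[] (code*-injective _ _
    (trans (sym (code-σ₀* w)) (trans eq (code-τ₀* w))))
    where
    start : ∀ w → w ≢ [] → σ₀* w ≡ τ₀* w → u ⟶* v
    start []         w≢[] _  = contradiction refl w≢[]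
    start (zero ∷ w) _    eq = ahead w (reachable-start u)
      (trans (sym (++-assoc (sepˡ (hat u ++ H)) _ _)) (∷-injectiveʳ (sym eq)))
    start (suc zero ∷ w)                _ ()
    start (suc (suc zero) ∷ w)          _ ()
    start (suc (suc (suc zero)) ∷ w)    _ ()
    start (suc (suc (suc (suc i))) ∷ w) _ ()

-- Computable functions on trees

renameExpr : ∀ {m n} → (Fin m → Fin n) → Expr m → Expr n
renameExpr ρ (var x)    = var (ρ x)
renameExpr ρ nil        = nil
renameExpr ρ (cons e f) = cons (renameExpr ρ e) (renameExpr ρ f)
renameExpr ρ (hd e)     = hd (renameExpr ρ e)
renameExpr ρ (tl e)     = tl (renameExpr ρ e)

rename : ∀ {m n} → (Fin m → Fin n) → Cmd m → Cmd n
rename ρ (x := e)              = ρ x := renameExpr ρ e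
rename ρ (c ⨾ d)               = rename ρ c ⨾ rename ρ d
rename ρ (if e then c else d)  = if renameExpr ρ e then rename ρ c else rename ρ d
rename ρ (while e loop c)      = while renameExpr ρ e loop rename ρ c

eval-rename : ∀ {m n} {ρ : Fin m → Fin n} {s s′} → (∀ x → Vec.lookup s′ (ρ x) ≡ Vec.lookup s x) →
  ∀ e → eval (renameExpr ρ e) s′ ≡ eval e s
eval-rename h (var x)    = h x
eval-rename h nil        = refl
eval-rename h (cons e f) = cong₂ _∙_ (eval-rename h e) (eval-rename h f)
eval-rename h (hd e)     = cong headᵗ (eval-rename h e)
eval-rename h (tl e)     = cong tailᵗ (eval-rename h e)

insertAt-update : ∀ {A : Set} {n} (s : Vec A n) i x (a b : A) →
  insertAt (s [ x ]≔ b) i a ≡ insertAt s i a [ punchIn i x ]≔ b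
insertAt-update s       zero    x       a b = refl
insertAt-update (c ∷ s) (suc i) zero    a b = refl
insertAt-update (c ∷ s) (suc i) (suc x) a b = cong (c ∷_) (insertAt-update s i x a b)

-- The renamed command neither reads nor writes cell `i`, so `a` travels along unchanged.
run-rename : ∀ {n} i a {c : Cmd n} {s s′} → ⟨ c , s ⟩⇓ s′ →
  ⟨ rename (punchIn i) c , insertAt s i a ⟩⇓ insertAt s′ i a
run-rename {n} i a = run
  where
  eval≡ : ∀ e s → eval (renameExpr (punchIn i) e) (insertAt s i a) ≡ eval e s
  eval≡ e s = eval-rename (insertAt-punchIn s i a) e
  run : ∀ {c : Cmd n} {s s′} → ⟨ c , s ⟩⇓ s′ →
    ⟨ rename (punchIn i) c , insertAt s i a ⟩⇓ insertAt s′ i a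
  run (assign {x} {e} {s}) = subst (⟨ _ , _ ⟩⇓_)
    (trans (cong (insertAt s i a [ punchIn i x ]≔_) (eval≡ e s)) (sym (insertAt-update s i x a _)))
    assign
  run (seq r r′)                      = seq (run r) (run r′)
  run {s = s} (if-yes {e} e≢ r)       = if-yes (λ z → e≢ (trans (sym (eval≡ e s)) z)) (run r)
  run {s = s} (if-no {e} e≡ r)        = if-no (trans (eval≡ e s) e≡) (run r)
  run {s = s} (while-go {e} e≢ r r′)  = while-go (λ z → e≢ (trans (sym (eval≡ e s)) z)) (run r) (run r′)
  run {s = s} (while-stop {e} e≡)     = while-stop (trans (eval≡ e s) e≡)

infixl 6 _»_

-- All terms denote total functions, so termination of the compiled loops comes for free. The
-- argument of a `fold` is a list paired with the initial accumulator.
data Fn : Set where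
  expr  : Expr 1 → Fn
  _»_   : Fn → Fn → Fn
  ⟪_,_⟫ : Fn → Fn → Fn
  fold  : Fn → Fn

foldTree : (Tree → Tree) → Tree → Tree → Tree
foldTree h nil      a = a
foldTree h (x ∙ xs) a = foldTree h xs (h (x ∙ a))

apply : Fn → Tree → Tree
apply (expr e)    t = eval e (t ∷ [])
apply (f » g)     t = apply g (apply f t)
apply ⟪ f , g ⟫   t = apply f t ∙ apply g t
apply (fold f)    t = foldTree (apply f) (headᵗ t) (tailᵗ t)

-- Variable 0 is an accumulator and variable 1 a stack.
compile : ∀ {n} → Fn → Cmd (suc (suc n))
compile (expr e)  = zero := renameExpr (λ _ → zero) e
compile (f » g)   = compile f ⨾ compile g
compile ⟪ f , g ⟫ =
  suc zero := cons (var zero) (var (suc zero)) ⨾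
  compile f ⨾
  -- The result of `f` is stored below the saved argument, which is then popped for `g`.
  suc zero := cons (hd (var (suc zero))) (cons (var zero) (tl (var (suc zero)))) ⨾
  zero := hd (var (suc zero)) ⨾
  suc zero := tl (var (suc zero)) ⨾
  compile g ⨾
  zero := cons (hd (var (suc zero))) (var zero) ⨾
  suc zero := tl (var (suc zero))
compile (fold f) =
  suc zero := cons (hd (var zero)) (var (suc zero)) ⨾
  zero := tl (var zero) ⨾
  while hd (var (suc zero)) loop
    (zero := cons (hd (hd (var (suc zero)))) (var zero) ⨾
     suc zero := cons (tl (hd (var (suc zero)))) (tl (var (suc zero))) ⨾
     compile f) ⨾
  suc zero := tl (var (suc zero))

-- That the stack `s` and the remaining store `r` come back unchanged is what lets terms run inside
-- pairs and loop bodies.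
compile-correct : ∀ {n} f t s {r : Store n} →
  ⟨ compile f , t ∷ s ∷ r ⟩⇓ apply f t ∷ s ∷ r
compile-correct (expr e) t s {r} =
  subst (λ t′ → ⟨ _ , _ ⟩⇓ t′ ∷ s ∷ r) (eval-rename (λ { zero → refl }) e) assign
compile-correct (f » g) t s = seq (compile-correct f t s) (compile-correct g _ s)
compile-correct ⟪ f , g ⟫ t s =
  seq assign (seq (compile-correct f t _) (seq assign (seq assign (seq assign
    (seq (compile-correct g t _) (seq assign assign))))))
compile-correct (fold f) t s =
  seq assign (seq assign (seq (go (headᵗ t) (tailᵗ t)) assign))
  where
  go : ∀ xs a → ⟨ _ , a ∷ (xs ∙ s) ∷ _ ⟩⇓ foldTree (apply f) xs a ∷ (nil ∙ s) ∷ _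
  go nil      a = while-stop refl
  go (x ∙ xs) a = while-go (λ ())
    (seq assign (seq assign (compile-correct f (x ∙ a) (xs ∙ s)))) (go xs _)

-- The variables of a program do not include the stack, which therefore has to
-- be inserted among them.
infixr 5 _▷_

_▷_ : Fn → Program → Program
f ▷ program c = program (compile f ⨾ rename (punchIn (suc zero)) c)

-- The compiled term leaves the stack `nil` and the other variables untouched, so `p` starts in the
-- store it expects, up to the inserted cell.
▷-correct : ∀ f p {t e} → p on apply f t outputs e → (f ▷ p) on t outputs e
▷-correct f (program c) {t} (a ∷ s , run , out) =
  a ∷ nil ∷ s , seq (compile-correct f t nil) (run-rename (suc zero) nil run) , out

-- Constants and right folds over encoded lists.

arg : Expr 1
arg = var zero

quoteTree : ∀ {n} → Tree → Expr n
quoteTree nil     = nil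
quoteTree (t ∙ u) = cons (quoteTree t) (quoteTree u)

eval-quoteTree : ∀ {n} t {s : Store n} → eval (quoteTree t) s ≡ t
eval-quoteTree nil     = refl
eval-quoteTree (t ∙ u) = cong₂ _∙_ (eval-quoteTree t) (eval-quoteTree u)

const : Tree → Fn
const t = expr (quoteTree t)

-- `fold (expr arg)` reverses a list, as an element paired with the accumulator is already the
-- longer list; a left fold over the reversal is a right fold.
foldʳ : Fn → Fn
foldʳ f = ⟪ ⟪ expr (hd arg) , expr nil ⟫ » fold (expr arg) , expr (tl arg) ⟫ » fold f

module _ {A : Set} (enc : A → Tree) where

  foldTree-encodeList : ∀ h xs t →
    foldTree h (encodeList enc xs) t ≡ foldl (λ t x → h (enc x ∙ t)) t xs
  foldTree-encodeList h []       t = refl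
  foldTree-encodeList h (x ∷ xs) t = foldTree-encodeList h xs (h (enc x ∙ t))

  foldTree-ʳ++ : ∀ xs ys →
    foldTree id (encodeList enc xs) (encodeList enc ys) ≡ encodeList enc (xs ʳ++ ys)
  foldTree-ʳ++ []       ys = refl
  foldTree-ʳ++ (x ∷ xs) ys = foldTree-ʳ++ xs (x ∷ ys)

  apply-foldʳ : ∀ f xs t →
    apply (foldʳ f) (encodeList enc xs ∙ t) ≡ foldr (λ x t → apply f (enc x ∙ t)) t xs
  apply-foldʳ f xs t =
    trans (cong (λ l → foldTree (apply f) l t) (foldTree-ʳ++ xs []))
   (trans (foldTree-encodeList (apply f) (reverse xs) t)
          (reverse-foldl (λ t x → apply f (enc x ∙ t)) t xs))

-- The reduction as a program

infixr 5 _◃_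

-- Since `encodeWord w` is `w ◃ nil`, images can be built from right to left by prepending to an
-- accumulator.
_◃_ : ∀ {n} → Word n → Tree → Tree
w ◃ t = foldr (λ a → encodeℕ (toℕ a) ∙_) t w

◃-++ : ∀ {n} (x y : Word n) t → (x ++ y) ◃ t ≡ x ◃ y ◃ t
◃-++ x y t = foldr-++ _ t x y

prefix : ∀ {m n} → Word m → Expr n → Expr n
prefix []      e = e
prefix (a ∷ w) e = cons (quoteTree (encodeℕ (toℕ a))) (prefix w e)

eval-prefix : ∀ {m n} (w : Word m) (e : Expr n) {s} → eval (prefix w e) s ≡ w ◃ eval e s
eval-prefix []      e = refl
eval-prefix (a ∷ w) e = cong₂ _∙_ (eval-quoteTree (encodeℕ (toℕ a))) (eval-prefix w e)

apply-const : ∀ t u → apply (const t) u ≡ t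
apply-const t u = eval-quoteTree t {u ∷ []}

module BitCoding {m} (g : Bool → Word m) where

  φ : List Bool → Word m
  φ = concatMap g

  φ-++ : ∀ x y t → φ (x ++ y) ◃ t ≡ φ x ◃ φ y ◃ t
  φ-++ x y t = trans (cong (_◃ t) (concatMap-++ g x y)) (◃-++ (φ x) (φ y) t)

  zerosFn padFn hatFn : Fn
  zerosFn = fold (expr (prefix (g false) (tl arg)))
  padFn   = zerosFn » expr (prefix (g false) arg)
  -- The closing delimiter is written first; the right fold then prepends, for each letter, its gap
  -- and the delimiter before it.
  hatFn   = ⟪ expr (hd arg) , expr (prefix (g true) (tl arg)) ⟫ »
            foldʳ (zerosFn » expr (prefix (g true) arg))

  -- `zerosFn` writes the last zero of a block first, whereas `zeros` unfolds from the front.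
  φ-zeros-comm : ∀ n t → φ (zeros n) ◃ g false ◃ t ≡ g false ◃ φ (zeros n) ◃ t
  φ-zeros-comm zero    t = refl
  φ-zeros-comm (suc n) t = begin
    φ (zeros (suc n)) ◃ g false ◃ t        ≡⟨ ◃-++ (g false) (φ (zeros n)) _ ⟩
    g false ◃ φ (zeros n) ◃ g false ◃ t    ≡⟨ cong (g false ◃_) (φ-zeros-comm n t) ⟩
    g false ◃ g false ◃ φ (zeros n) ◃ t    ≡⟨ cong (g false ◃_) (◃-++ (g false) (φ (zeros n)) t) ⟨
    g false ◃ φ (zeros (suc n)) ◃ t        ∎

  apply-zerosFn : ∀ n t → apply zerosFn (encodeℕ n ∙ t) ≡ φ (zeros n) ◃ t
  apply-zerosFn zero    t = refl
  apply-zerosFn (suc n) t = begin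
    apply zerosFn (encodeℕ n ∙ eval (prefix (g false) (tl arg)) _)
      ≡⟨ cong (λ t → apply zerosFn (encodeℕ n ∙ t)) (eval-prefix (g false) (tl arg)) ⟩
    apply zerosFn (encodeℕ n ∙ (g false ◃ t))  ≡⟨ apply-zerosFn n (g false ◃ t) ⟩
    φ (zeros n) ◃ g false ◃ t                  ≡⟨ φ-zeros-comm n t ⟩
    g false ◃ φ (zeros n) ◃ t                  ≡⟨ ◃-++ (g false) (φ (zeros n)) t ⟨
    φ (zeros (suc n)) ◃ t                      ∎

  apply-padFn : ∀ n t → apply padFn (encodeℕ n ∙ t) ≡ φ (pad n) ◃ t
  apply-padFn n t = begin
    apply padFn (encodeℕ n ∙ t)                ≡⟨ eval-prefix (g false) arg ⟩
    g false ◃ apply zerosFn (encodeℕ n ∙ t)    ≡⟨ cong (g false ◃_) (apply-zerosFn n t) ⟩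
    g false ◃ φ (zeros n) ◃ t                  ≡⟨ ◃-++ (g false) (φ (zeros n)) t ⟨
    φ (pad n) ◃ t                              ∎

  apply-hatFn : ∀ {n} (x : Word n) t → apply hatFn (encodeWord x ∙ t) ≡ φ (hat x) ◃ t
  apply-hatFn x t = trans (apply-foldʳ _ step x _) (go x)
    where
    step : Fn
    step = zerosFn » expr (prefix (g true) arg)
    -- `s` is the encoding of the whole input word, which stays fixed while `x` shrinks.
    go : ∀ {n} (x : Word n) {s} →
      foldr (λ a t → apply step (encodeℕ (toℕ a) ∙ t))
            (eval (prefix (g true) (tl arg)) ((s ∙ t) ∷ [])) x
        ≡ φ (hat x) ◃ t
    go []      = trans (eval-prefix (g true) (tl arg)) (sym (◃-++ (g true) [] t))
    go (a ∷ x) = begin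
      _
        ≡⟨ cong (λ t → apply step (encodeℕ (toℕ a) ∙ t)) (go x) ⟩
      apply step (encodeℕ (toℕ a) ∙ (φ (hat x) ◃ t))
        ≡⟨ eval-prefix (g true) arg ⟩
      g true ◃ apply zerosFn (encodeℕ (toℕ a) ∙ (φ (hat x) ◃ t))
        ≡⟨ cong (g true ◃_) (apply-zerosFn (toℕ a) _) ⟩
      g true ◃ φ (zeros (toℕ a)) ◃ φ (hat x) ◃ t
        ≡⟨ cong (g true ◃_) (φ-++ (zeros (toℕ a)) (hat x) t) ⟨
      g true ◃ φ (gaps (a ∷ x)) ◃ t
        ≡⟨ ◃-++ (g true) (φ (gaps (a ∷ x))) t ⟨
      φ (hat (a ∷ x)) ◃ t                      ∎

  hatsFn : Expr 1 → Fn
  hatsFn e = foldʳ ⟪ ⟪ expr e , expr nil ⟫ » hatFn , expr (tl arg) ⟫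

  apply-hatsFn : ∀ {A : Set} {n} (enc : A → Tree) (π : A → Word n) e →
    (∀ a {t} → eval e ((enc a ∙ t) ∷ []) ≡ encodeWord (π a)) →
    ∀ as → apply (hatsFn e) (encodeList enc as ∙ nil) ≡
      encodeList encodeWord (map (φ ∘ hat ∘ π) as)
  apply-hatsFn enc π e h as = trans (apply-foldʳ enc step as nil) (go as)
    where
    step : Fn
    step = ⟪ ⟪ expr e , expr nil ⟫ » hatFn , expr (tl arg) ⟫
    go : ∀ as → foldr (λ a t → apply step (enc a ∙ t)) nil as ≡
      encodeList encodeWord (map (φ ∘ hat ∘ π) as)
    go []       = refl
    go (a ∷ as) = cong₂ _∙_
      (trans (cong (λ t → apply hatFn (t ∙ nil)) (h a)) (apply-hatFn (π a) nil))
      (go as)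

  -- Serves the long images of both begin and end; `w` is what follows the queue contents.
  boundaryFn : Expr 1 → Expr 1 → Word m → Fn
  boundaryFn e n w =
    ⟪ expr e , ⟪ expr n , const (encodeWord w) ⟫ » padFn ⟫ » hatFn

  apply-boundaryFn : ∀ e n w t {c} (x : Word c) →
    eval e (t ∷ []) ≡ encodeWord x → eval n (t ∷ []) ≡ encodeℕ c →
    apply (boundaryFn e n w) t ≡ encodeWord (φ (hat x ++ pad c) ++ w)
  apply-boundaryFn e n w t {c} x eq eq′ = begin
    apply (boundaryFn e n w) t
      ≡⟨ cong (apply hatFn) (cong₂ (λ a b → a ∙ apply padFn b) eq
          (cong₂ _∙_ eq′ (eval-quoteTree (encodeWord w)))) ⟩
    apply hatFn (encodeWord x ∙ apply padFn (encodeℕ c ∙ encodeWord w))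
      ≡⟨ cong (λ t → apply hatFn (encodeWord x ∙ t)) (apply-padFn c (encodeWord w)) ⟩
    apply hatFn (encodeWord x ∙ (φ (pad c) ◃ encodeWord w))
      ≡⟨ apply-hatFn x _ ⟩
    φ (hat x) ◃ φ (pad c) ◃ w ◃ nil
      ≡⟨ φ-++ (hat x) (pad c) _ ⟨
    φ (hat x ++ pad c) ◃ w ◃ nil
      ≡⟨ ◃-++ (φ (hat x ++ pad c)) w nil ⟨
    encodeWord (φ (hat x ++ pad c) ++ w) ∎

gˡ gʳ : Bool → Word 2
gˡ b = code* (sep ∷ bit b ∷ [])
gʳ b = code* (bit b ∷ sep ∷ [])

module Sepˡ = BitCoding gˡ
module Sepʳ = BitCoding gʳ

cardExpr rulesExpr uExpr vExpr : Expr 1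
cardExpr  = hd (hd arg)
rulesExpr = tl (hd arg)
uExpr     = hd (tl arg)
vExpr     = tl (tl arg)

σFn τFn : Fn
σFn = ⟪ const (encodeWord (code* (mark ∷ [])))
      , ⟪ Sepˡ.boundaryFn vExpr cardExpr (code* (sep ∷ mark ∷ []))
        , ⟪ const (encodeWord (gˡ false))
          , ⟪ const (encodeWord (gˡ true))
            , expr (cons rulesExpr nil) » Sepˡ.hatsFn (hd (hd arg)) ⟫ ⟫ ⟫ ⟫
τFn = ⟪ Sepˡ.boundaryFn uExpr cardExpr (code* (sep ∷ [])) » expr (prefix (code mark) arg)
      , ⟪ const (encodeWord (code* (mark ∷ [])))
        , ⟪ const (encodeWord (gʳ false))
          , ⟪ const (encodeWord (gʳ true))
            , expr (cons rulesExpr nil) » Sepʳ.hatsFn (tl (hd arg)) ⟫ ⟫ ⟫ ⟫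

-- The number of rules is fixed, so the size of the new alphabet is a constant of the program.
reduction : ℕ → Fn
reduction k = ⟪ const (encodeℕ (k + 4)) , ⟪ σFn , τFn ⟫ ⟫

-- Agreement of the program with the reduction.

module Correctness (I : AccessibilityInstance) where

  open AccessibilityInstance I
  open Queue system using (H)
  open PostSystem I

  input : Tree
  input = Problem.encode Accessibility I

  encode-morphism : ∀ f → encodeMorphism (morphism f) ≡ encodeList encodeWord (tabulate (code* ∘ f))
  encode-morphism f = cong (encodeList encodeWord) (tabulate-cong λ a → ++-identityʳ (code* (f a)))

  tabulate-rules : ∀ {A : Set} (f : Word card × Word card → A) →
    map f rules ≡ tabulate (f ∘ lookup rules)
  tabulate-rules f = trans (cong (map f) (sym (tabulate-lookup rules))) (map-tabulate (lookup rules) f)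

  encodeRules : ∀ (g : Bool → Word 2) h (π : Word card × Word card → Word card) →
    (∀ x → concatMap g x ≡ code* (concatMap h x)) →
    encodeList encodeWord (map (concatMap g ∘ hat ∘ π) rules) ≡
    encodeList encodeWord (tabulate λ i → code* (concatMap h (hat (π (lookup rules i)))))
  encodeRules g h π eq = cong (encodeList encodeWord)
    (trans (tabulate-rules _) (tabulate-cong λ i → eq (hat (π (lookup rules i)))))

  φˡ : ∀ x → Sepˡ.φ x ≡ code* (sepˡ x)
  φˡ = concatMap-concatMap code _

  φʳ : ∀ x → Sepʳ.φ x ≡ code* (sepʳ x)
  φʳ = concatMap-concatMap code _

  boundary : ∀ (x : Word card) w → Sepˡ.φ (hat x ++ H) ++ code* w ≡ code* (sepˡ (hat x ++ H) ++ w)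
  boundary x w = trans (cong (_++ code* w) (φˡ (hat x ++ H)))
    (sym (concatMap-++ code (sepˡ (hat x ++ H)) w))

  apply-σFn : apply σFn input ≡ encodeMorphism (morphism σ₀)
  apply-σFn = trans
    (cong₂ _∙_ (apply-const (encodeWord (code* (mark ∷ []))) input)
    (cong₂ _∙_ (trans (Sepˡ.apply-boundaryFn vExpr cardExpr (code* (sep ∷ mark ∷ [])) input v refl refl)
                      (cong encodeWord (boundary v (sep ∷ mark ∷ []))))
    (cong₂ _∙_ (apply-const (encodeWord (gˡ false)) input)
    (cong₂ _∙_ (apply-const (encodeWord (gˡ true)) input)
      (trans (Sepˡ.apply-hatsFn _ proj₁ (hd (hd arg)) (λ _ → refl) rules)
             (encodeRules gˡ _ proj₁ φˡ))))))
    (sym (encode-morphism σ₀))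

  apply-τFn : apply τFn input ≡ encodeMorphism (morphism τ₀)
  apply-τFn = trans
    (cong₂ _∙_ (trans (eval-prefix (code mark) arg
                  {apply (Sepˡ.boundaryFn uExpr cardExpr (code* (sep ∷ []))) input ∷ []})
                 (cong (code mark ◃_) (trans
                      (Sepˡ.apply-boundaryFn uExpr cardExpr (code* (sep ∷ [])) input u refl refl)
                      (cong encodeWord (boundary u (sep ∷ []))))))
    (cong₂ _∙_ (apply-const (encodeWord (code* (mark ∷ []))) input)
    (cong₂ _∙_ (apply-const (encodeWord (gʳ false)) input)
    (cong₂ _∙_ (apply-const (encodeWord (gʳ true)) input)
      (trans (Sepʳ.apply-hatsFn _ proj₂ (tl (hd arg)) (λ _ → refl) rules)
             (encodeRules gʳ _ proj₂ φʳ))))))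
    (sym (encode-morphism τ₀))

  card-pcp : ∀ {k} → length rules ≡ k → PCPInstance.card pcp ≡ k + 4
  card-pcp refl = +-comm 4 (length rules)

  apply-reduction : ∀ {k} → length rules ≡ k → apply (reduction k) input ≡ Problem.encode PCP pcp
  apply-reduction {k} eq = cong₂ _∙_
    (trans (apply-const (encodeℕ (k + 4)) input) (cong encodeℕ (sym (card-pcp eq))))
    (cong₂ _∙_ apply-σFn apply-τFn)

Reflects-⇔ : ∀ {P Q : Set} {b} → (P → Q) → (Q → P) → Reflects P b → Reflects Q b
Reflects-⇔ f g (ofʸ p)  = ofʸ (f p)
Reflects-⇔ f g (ofⁿ ¬p) = ofⁿ (¬p ∘ g)

corollary2 : (k : ℕ) → k ≥ 1 →
    Decidable (PCP[ k + 4 ] restrictedTo λ I → ErasementFree (proj₁ I)) →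
    Decidable Accessibility[ k ]
corollary2 k _ (p , decides) = reduction k ▷ p , λ (I , eq) →
  let open PostSystem I
      open Correctness I
      b , out , answer = decides ((pcp , card-pcp eq) , pcp-erasementFree)
  in b
   , ▷-correct (reduction k) p (subst (p on_outputs encodeBool b) (sym (apply-reduction eq)) out)
   , Reflects-⇔ derivation solution answer
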